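{- For every integer $k\ge 1$, $sat_{\circlearrowright}(n,X_k)=O(1)$, where $X_k$ is the cyclically ordered matching on vertex set $[2k+4]$ (with the natural cyclic order $1,2,\dots,2k+4$) and edge set $\{\{1,2k+3\},\{2,2k+4\}\}\cup\{\{2i+1,2i+2\}: i=1,\dots,k\}$.
   Context: A cyclically ordered graph is a finite simple graph whose vertex set is cyclically ordered. $H$ contains $C$ if there is an injective cyclic-order-preserving map $\varphi:V(C)\to V(H)$ with $\varphi(u)\varphi(v)\in E(H)$ for all $uv\in E(C)$; otherwise $H$ avoids $C$. $H$ saturates $C$ if $H$ avoids $C$ but adding any non-edge to $H$ yields a graph containing $C$. $sat_{\circlearrowright}(n,C)$ is the minimum number of edges of a cyclically ordered graph on $n$ vertices saturating $C$. -}

module Defs where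

open import Data.Nat using (ℕ; zero; suc; _+_; _*_; _≤_; _<_)
open import Data.Fin using (Fin; toℕ)
open import Data.Fin.Properties using (_≟_)
open import Data.Bool using (Bool; true; false; _∧_)
open import Data.List using (List; allFin; map)
open import Data.Nat.ListAction using (sum)
open import Data.Product using (Σ; _×_; ∃; ∃-syntax)
open import Data.Sum using (_⊎_)
open import Relation.Nullary using (¬_; Dec; yes; no)
open import Relation.Nullary.Decidable using (⌊_⌋)
open import Relation.Binary.PropositionalEquality using (_≡_; _≢_)
open import Function.Definitions using (Injective)
import Data.Nat as ℕ

-- A cyclically ordered graph on n vertices: vertex set Fin n with the natural
-- cyclic order 0,1,...,n-1; a finite simple graph given by a symmetric,
-- irreflexive Boolean adjacency function.
record Graph (n : ℕ) : Set where
  field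
    adj  : Fin n → Fin n → Bool
    symm : ∀ i j → adj i j ≡ adj j i
    irr  : ∀ i → adj i i ≡ false
open Graph public

E : ∀ {n} → Graph n → Fin n → Fin n → Set
E G i j = adj G i j ≡ true

edgeCount : ∀ {n} → Graph n → ℕ
edgeCount {n} G =
  sum (map (λ i → sum (map (λ j → if? i j) (allFin n))) (allFin n))
  where
  if? : Fin n → Fin n → ℕ
  if? i j with ⌊ toℕ i ℕ.<? toℕ j ⌋ ∧ adj G i j
  ... | true  = 1
  ... | false = 0

Cyc : ∀ {n} → Fin n → Fin n → Fin n → Set
Cyc a b c =
  (toℕ a < toℕ b × toℕ b < toℕ c) ⊎
  (toℕ b < toℕ c × toℕ c < toℕ a) ⊎
  (toℕ c < toℕ a × toℕ a < toℕ b)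

CycPreserving : ∀ {m n} → (Fin m → Fin n) → Set
CycPreserving φ = ∀ a b c → Cyc a b c → Cyc (φ a) (φ b) (φ c)

Contains : ∀ {m n} → (Fin m → Fin m → Set) → (Fin n → Fin n → Set) → Set
Contains {m} {n} P R =
  Σ (Fin m → Fin n) λ φ →
    Injective _≡_ _≡_ φ × CycPreserving φ × (∀ a b → P a b → R (φ a) (φ b))

Avoids : ∀ {m n} → (Fin m → Fin m → Set) → (Fin n → Fin n → Set) → Set
Avoids P R = ¬ Contains P R

plusEdge : ∀ {n} → Graph n → Fin n → Fin n → Fin n → Fin n → Set
plusEdge H u v i j = E H i j ⊎ (i ≡ u × j ≡ v) ⊎ (i ≡ v × j ≡ u)

Saturates : ∀ {m n} → (Fin m → Fin m → Set) → Graph n → Set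
Saturates P H =
  Avoids P (E H) ×
  (∀ u v → u ≢ v → ¬ E H u v → Contains P (plusEdge H u v))

-- X_k, 0-indexed on Fin (2k+4): paper's vertex x is our x-1.
-- Edges {1,2k+3} ↦ {0,2k+2}, {2,2k+4} ↦ {1,2k+3},
-- {2i+1,2i+2} ↦ {2i,2i+1} for i = 1..k.
XE' : (k : ℕ) → Fin (2 * k + 4) → Fin (2 * k + 4) → Set
XE' k a b =
  (toℕ a ≡ 0 × toℕ b ≡ 2 * k + 2) ⊎
  (toℕ a ≡ 1 × toℕ b ≡ 2 * k + 3) ⊎
  (∃[ i ] (1 ≤ i × i ≤ k × toℕ a ≡ 2 * i × toℕ b ≡ 2 * i + 1))

X : (k : ℕ) → Fin (2 * k + 4) → Fin (2 * k + 4) → Set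
X k a b = XE' k a b ⊎ XE' k b a

{-# OPTIONS --safe #-}

-- Let h = 2k + 1 and m = 2h, and let G be the Möbius ladder on the vertices 0,…,m−1 (rim edges
-- x ~ x+1 and 0 ~ m−1, diagonals x ~ x+h), all other vertices being isolated.  G avoids X_k: an
-- edge of G that is crossed by another one is a diagonal, and of the h − 1 = 2k vertices of the
-- arc that has to hold the k short edges of X_k one is an end of the crossing edge.  Adding any
-- edge with an end outside 0,…,m−1, however, creates a copy of X_k.  Hence a saturated graph
-- H ⊇ G, which is obtained greedily, has all its edges among the first m vertices.
module Submission where

open import Defs
open import Data.Bool using (true; false; _∧_)
import Data.Bool.Properties as Bool
open import Data.Empty using (⊥-elim)
open import Data.Fin using (Fin; toℕ; fromℕ<; zero; suc; finToFun; funToFin)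
open import Data.Fin.Properties as Fin
  using (any?; all?; finToFun-funToFin; toℕ-injective; toℕ-fromℕ<; toℕ<n)
open import Data.List using ([]; _∷_; allFin; map; tabulate; cartesianProduct)
open import Data.List.Properties using (map-tabulate)
open import Data.List.Membership.Propositional using (_∈_)
open import Data.List.Membership.Propositional.Properties using (∈-cartesianProduct⁺; ∈-allFin)
open import Data.List.Relation.Unary.Any using (here; there)
open import Data.Nat
  using (ℕ; zero; suc; _+_; _*_; _≤_; _<_; z≤n; s≤s; s≤s⁻¹; _<?_; _≤?_; NonZero; >-nonZero)
open import Data.Nat.DivMod using (_mod_; m<n⇒m%n≡m)
open import Data.Nat.ListAction using (sum)
open import Data.Nat.Properties as ℕ hiding (_<?_; _≤?_)
open import Data.Product using (_×_; _,_; proj₁; proj₂; ∃-syntax)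
open import Data.Sum using (_⊎_; inj₁; inj₂; [_,_]′; swap)
open import Function using (_∘_; id; mk⇔)
open import Function.Definitions using (Injective)
open import Relation.Binary.Definitions using (tri<; tri≈; tri>)
open import Relation.Binary.PropositionalEquality
open import Relation.Nullary using (¬_; Dec; yes; no)
open import Relation.Nullary.Decidable
  using (map′; _×-dec_; _⊎-dec_; _→-dec_; ⌊_⌋; does; dec-true; dec-false; does-⇔)

-- Monotonicity and decidability of containment.

Contains-mono : ∀ {m n} {P : Fin m → Fin m → Set} {R S : Fin n → Fin n → Set} →
  (∀ i j → R i j → S i j) → Contains P R → Contains P S
Contains-mono R⊆S (φ , inj , cyc , edges) = φ , inj , cyc , λ a b e → R⊆S _ _ (edges a b e)

plusEdge-mono : ∀ {n} {G H : Graph n} → (∀ i j → E G i j → E H i j) →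
  ∀ u v i j → plusEdge G u v i j → plusEdge H u v i j
plusEdge-mono G⊆H u v i j (inj₁ e) = inj₁ (G⊆H i j e)
plusEdge-mono G⊆H u v i j (inj₂ e) = inj₂ e

plusEdge? : ∀ {n} (G : Graph n) u v i j → Dec (plusEdge G u v i j)
plusEdge? G u v i j =
  (adj G i j Bool.≟ true) ⊎-dec
  ((i Fin.≟ u) ×-dec (j Fin.≟ v)) ⊎-dec ((i Fin.≟ v) ×-dec (j Fin.≟ u))

plusEdge-sym : ∀ {n} (G : Graph n) u v {i j} → plusEdge G u v i j → plusEdge G u v j i
plusEdge-sym G u v {i} {j} (inj₁ e) = inj₁ (trans (symm G j i) e)
plusEdge-sym G u v (inj₂ (inj₁ (p , q))) = inj₂ (inj₂ (q , p))
plusEdge-sym G u v (inj₂ (inj₂ (p , q))) = inj₂ (inj₁ (q , p))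

-- Embeddings are enumerated by Fin (n ^ m); each one is only known pointwise after decoding.
Contains? : ∀ {m n} {P : Fin m → Fin m → Set} {R : Fin n → Fin n → Set} →
  (∀ a b → Dec (P a b)) → (∀ i j → Dec (R i j)) → Dec (Contains P R)
Contains? {m} {n} {P} {R} P? R? =
  map′ (λ (x , inj , rest) → finToFun x , (λ {a} {b} → inj a b) , rest)
       (λ (φ , inj , rest) →
          funToFin φ , good-resp (λ i → sym (finToFun-funToFin φ i)) ((λ _ _ → inj) , rest))
       (any? (good? ∘ finToFun))
  where
  Good : (Fin m → Fin n) → Set
  Good φ =
    (∀ a b → φ a ≡ φ b → a ≡ b) × CycPreserving φ × (∀ a b → P a b → R (φ a) (φ b))

  cyc? : ∀ {l} (a b c : Fin l) → Dec (Cyc a b c)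
  cyc? a b c =
    ((toℕ a <? toℕ b) ×-dec (toℕ b <? toℕ c)) ⊎-dec
    ((toℕ b <? toℕ c) ×-dec (toℕ c <? toℕ a)) ⊎-dec
    ((toℕ c <? toℕ a) ×-dec (toℕ a <? toℕ b))

  good? : ∀ φ → Dec (Good φ)
  good? φ =
    all? (λ a → all? λ b → (φ a Fin.≟ φ b) →-dec (a Fin.≟ b)) ×-dec
    all? (λ a → all? λ b → all? λ c → cyc? a b c →-dec cyc? (φ a) (φ b) (φ c)) ×-dec
    all? (λ a → all? λ b → P? a b →-dec R? (φ a) (φ b))

  good-resp : ∀ {φ ψ} → φ ≗ ψ → Good φ → Good ψ
  good-resp φ≗ψ (inj , cyc , edges) =
    (λ a b eq → inj a b (trans (φ≗ψ a) (trans eq (sym (φ≗ψ b))))) ,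
    (λ a b c abc → subst (Cyc _ _) (φ≗ψ c)
      (subst₂ (λ x y → Cyc x y _) (φ≗ψ a) (φ≗ψ b) (cyc a b c abc))) ,
    (λ a b ab → subst₂ R (φ≗ψ a) (φ≗ψ b) (edges a b ab))

-- Graphs from decidable relations and greedy saturation.

module _ {n : ℕ} {R : Fin n → Fin n → Set} (R? : ∀ i j → Dec (R i j))
         (R-sym : ∀ {i j} → R i j → R j i) (R-irrefl : ∀ i → ¬ R i i) where

  fromRel : Graph n
  fromRel = record
    { adj  = λ i j → does (R? i j)
    ; symm = λ i j → does-⇔ (mk⇔ R-sym R-sym) (R? i j) (R? j i)
    ; irr  = λ i → dec-false (R? i i) (R-irrefl i)
    }

  E⇒R : ∀ i j → E fromRel i j → R i j
  E⇒R i j e with R? i j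
  ... | yes r = r

  R⇒E : ∀ i j → R i j → E fromRel i j
  R⇒E i j = dec-true (R? i j)

module _ {m n : ℕ} {P : Fin m → Fin m → Set} (P? : ∀ a b → Dec (P a b)) where

  SaturatesAt : Graph n → Fin n × Fin n → Set
  SaturatesAt H (u , v) = u ≢ v → ¬ E H u v → Contains P (plusEdge H u v)

  -- A larger graph has fewer non-edges and keeps every copy of `P`. A pair settled once therefore
  -- stays settled, and a single pass over all pairs suffices.
  saturatesAt-mono : ∀ {G H} → (∀ i j → E G i j → E H i j) →
    ∀ uv → SaturatesAt G uv → SaturatesAt H uv
  saturatesAt-mono {G} {H} G⊆H (u , v) sat u≢v uv∉H =
    Contains-mono (plusEdge-mono {G = G} {H} G⊆H u v) (sat u≢v (uv∉H ∘ G⊆H u v))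

  -- Two distinct vertices are joined exactly when this creates no copy of `P`, which is decidable.
  -- If it does create one, the copy itself settles the pair.
  saturateAt : (G : Graph n) → Avoids P (E G) → ∀ uv →
    ∃[ H ] ((∀ i j → E G i j → E H i j) × Avoids P (E H) × SaturatesAt H uv)
  saturateAt G avoids (u , v) with Contains? P? (plusEdge? G u v) | u Fin.≟ v
  ... | yes c | _      = G , (λ _ _ e → e) , avoids , λ _ _ → c
  ... | no ¬c | yes eq = G , (λ _ _ e → e) , avoids , λ u≢v _ → ⊥-elim (u≢v eq)
  ... | no ¬c | no u≢v =
    H , (λ i j e → R⇒E (plusEdge? G u v) (plusEdge-sym G u v) irrefl i j (inj₁ e)) ,
    ¬c ∘ Contains-mono (E⇒R (plusEdge? G u v) (plusEdge-sym G u v) irrefl) ,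
    λ _ uv∉H → ⊥-elim (uv∉H
      (R⇒E (plusEdge? G u v) (plusEdge-sym G u v) irrefl u v (inj₂ (inj₁ (refl , refl)))))
    where
    irrefl : ∀ i → ¬ plusEdge G u v i i
    irrefl i (inj₁ e) with () ← trans (sym e) (irr G i)
    irrefl i (inj₂ (inj₁ (p , q))) = u≢v (trans (sym p) q)
    irrefl i (inj₂ (inj₂ (p , q))) = u≢v (trans (sym q) p)

    H : Graph n
    H = fromRel (plusEdge? G u v) (plusEdge-sym G u v) irrefl

  saturateAll : (G : Graph n) → Avoids P (E G) → ∀ uvs →
    ∃[ H ] ((∀ i j → E G i j → E H i j) × Avoids P (E H) ×
            (∀ {uv} → uv ∈ uvs → SaturatesAt H uv))
  saturateAll G avoids [] = G , (λ _ _ e → e) , avoids , λ ()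
  saturateAll G avoids (uv ∷ uvs) with saturateAll G avoids uvs
  ... | H , G⊆H , avoids-H , sat with saturateAt H avoids-H uv
  ... | K , H⊆K , avoids-K , sat-uv =
    K , (λ i j → H⊆K i j ∘ G⊆H i j) , avoids-K ,
    λ { (here refl) → sat-uv ; (there x) → saturatesAt-mono {H} {K} H⊆K _ (sat x) }

  extend-to-saturated : (G : Graph n) → Avoids P (E G) →
    ∃[ H ] ((∀ i j → E G i j → E H i j) × Saturates P H)
  extend-to-saturated G avoids
    with H , G⊆H , avoids-H , sat ← saturateAll G avoids (cartesianProduct (allFin n) (allFin n)) =
    H , G⊆H , avoids-H , λ u v → sat (∈-cartesianProduct⁺ (∈-allFin u) (∈-allFin v))

-- Counting edges among the first `m` vertices.

sum-support : ∀ {n} m b (f : Fin n → ℕ) → (∀ i → f i ≤ b) → (∀ i → m ≤ toℕ i → f i ≡ 0) →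
  sum (map f (allFin n)) ≤ m * b
sum-support {n} m b f f≤b f≡0 =
  -- In the `tabulate` form, peeling off the first index leaves a function on a smaller `Fin`, so
  -- induction applies.
  subst (λ l → sum l ≤ m * b) (sym (map-tabulate id f)) (go m f f≤b f≡0)
  where
  go : ∀ {n} m (f : Fin n → ℕ) → (∀ i → f i ≤ b) → (∀ i → m ≤ toℕ i → f i ≡ 0) →
    sum (tabulate f) ≤ m * b
  go {zero}  m       f f≤b f≡0 = z≤n
  go {suc n} zero    f f≤b f≡0 =
    +-mono-≤ (≤-reflexive (f≡0 zero z≤n)) (go 0 (f ∘ suc) (f≤b ∘ suc) (λ i _ → f≡0 (suc i) z≤n))
  go {suc n} (suc m) f f≤b f≡0 =
    +-mono-≤ (f≤b zero) (go m (f ∘ suc) (f≤b ∘ suc) (λ i m≤i → f≡0 (suc i) (s≤s m≤i)))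

sum²-support : ∀ {n} m (f : Fin n → Fin n → ℕ) → (∀ i j → f i j ≤ 1) →
  (∀ i j → m ≤ toℕ i ⊎ m ≤ toℕ j → f i j ≡ 0) →
  sum (map (λ i → sum (map (λ j → f i j) (allFin n))) (allFin n)) ≤ m * (m * 1)
sum²-support m f f≤1 f≡0 = sum-support m (m * 1) _
  (λ i → sum-support m 1 (f i) (f≤1 i) (λ j m≤j → f≡0 i j (inj₂ m≤j)))
  -- A row outside the support is summed with support size 0, which bounds its sum by 0.
  (λ i m≤i → n≤0⇒n≡0 (sum-support 0 1 (f i) (f≤1 i) (λ j _ → f≡0 i j (inj₁ m≤i))))

-- The summand of edgeCount is local to its definition, so it can only be named by unification:
-- the two lemmas about it are stated with a hole that edgeCount-support solves.
module _ {n : ℕ} (m : ℕ) (H : Graph n) (outside : ∀ i j → m ≤ toℕ i ⊎ m ≤ toℕ j → ¬ E H i j) where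
  mutual
    edgeCount-support : edgeCount H ≤ m * (m * 1)
    edgeCount-support = sum²-support m _ at-most-one vanishes

    at-most-one : ∀ i j → _ ≤ 1
    at-most-one i j with ⌊ toℕ i <? toℕ j ⌋ ∧ adj H i j
    ... | true  = ≤-refl
    ... | false = z≤n

    vanishes : ∀ i j → m ≤ toℕ i ⊎ m ≤ toℕ j → _ ≡ 0
    -- Abstracting `outside i j out` together with `adj H i j` turns it into a refutation of
    -- `true ≡ true` in the first case.
    vanishes i j out with ⌊ toℕ i <? toℕ j ⌋ | adj H i j | outside i j out
    ... | true  | true  | ij∉H = ⊥-elim (ij∉H refl)
    ... | true  | false | _    = refl
    ... | false | _     | _    = refl

X? : ∀ k a b → Dec (X k a b)
X? k a b = XE'? a b ⊎-dec XE'? b a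
  where
  XE'? : ∀ a b → Dec (XE' k a b)
  XE'? a b =
    ((toℕ a ℕ.≟ 0) ×-dec (toℕ b ℕ.≟ 2 * k + 2)) ⊎-dec
    ((toℕ a ℕ.≟ 1) ×-dec (toℕ b ℕ.≟ 2 * k + 3)) ⊎-dec
    map′ (λ (i , i<1+k , 1≤i , eqs) → i , 1≤i , s≤s⁻¹ i<1+k , eqs)
         (λ (i , 1≤i , i≤k , eqs) → i , s≤s i≤k , 1≤i , eqs)
         -- The search runs strictly below its bound, hence `suc k` for `i ≤ k`.
         (anyUpTo? (λ i → (1 ≤? i) ×-dec (toℕ a ℕ.≟ 2 * i) ×-dec (toℕ b ℕ.≟ 2 * i + 1)) (suc k))

-- Cyclic order on the natural numbers.

Cycℕ : ℕ → ℕ → ℕ → Set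
Cycℕ a b c = (a < b × b < c) ⊎ (b < c × c < a) ⊎ (c < a × a < b)

cyc-rotate : ∀ {a b c} → Cycℕ a b c → Cycℕ b c a
cyc-rotate (inj₁ p)        = inj₂ (inj₂ p)
cyc-rotate (inj₂ (inj₁ p)) = inj₁ p
cyc-rotate (inj₂ (inj₂ p)) = inj₂ (inj₁ p)

-- Cutting the circle open at `o` leaves a linear order on the other points; this is its
-- transitivity.
cyc-trans : ∀ {o x y z} → Cycℕ o x y → Cycℕ o y z → Cycℕ o x z
cyc-trans (inj₁ (o<x , x<y))        (inj₁ (o<y , y<z))        = inj₁ (o<x , <-trans x<y y<z)
cyc-trans (inj₁ (o<x , x<y))        (inj₂ (inj₁ (y<z , z<o))) = inj₂ (inj₂ (z<o , o<x))
cyc-trans (inj₁ (o<x , x<y))        (inj₂ (inj₂ (z<o , o<y))) = inj₂ (inj₂ (z<o , o<x))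
cyc-trans (inj₂ (inj₁ (x<y , y<o))) (inj₁ (o<y , y<z))        = ⊥-elim (<-asym y<o o<y)
cyc-trans (inj₂ (inj₁ (x<y , y<o))) (inj₂ (inj₁ (y<z , z<o))) = inj₂ (inj₁ (<-trans x<y y<z , z<o))
cyc-trans (inj₂ (inj₁ (x<y , y<o))) (inj₂ (inj₂ (z<o , o<y))) = ⊥-elim (<-asym y<o o<y)
cyc-trans (inj₂ (inj₂ (y<o , o<x))) (inj₁ (o<y , y<z))        = ⊥-elim (<-asym y<o o<y)
cyc-trans (inj₂ (inj₂ (y<o , o<x))) (inj₂ (inj₁ (y<z , z<o))) = inj₂ (inj₂ (z<o , o<x))
cyc-trans (inj₂ (inj₂ (y<o , o<x))) (inj₂ (inj₂ (z<o , o<y))) = ⊥-elim (<-asym y<o o<y)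

-- The three points increase in the linear order cut open at `o`, and an increasing triple is cyclic
-- wherever the circle is cut.
cyc-change-base : ∀ {o x y z} → Cycℕ o x y → Cycℕ o y z → Cycℕ x y z
cyc-change-base (inj₁ (o<x , x<y))        (inj₁ (o<y , y<z))        = inj₁ (x<y , y<z)
cyc-change-base (inj₁ (o<x , x<y))        (inj₂ (inj₁ (y<z , z<o))) = inj₁ (x<y , y<z)
cyc-change-base (inj₁ (o<x , x<y))        (inj₂ (inj₂ (z<o , o<y))) = inj₂ (inj₂ (<-trans z<o o<x , x<y))
cyc-change-base (inj₂ (inj₁ (x<y , y<o))) (inj₁ (o<y , y<z))        = inj₁ (x<y , y<z)
cyc-change-base (inj₂ (inj₁ (x<y , y<o))) (inj₂ (inj₁ (y<z , z<o))) = inj₁ (x<y , y<z)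
cyc-change-base (inj₂ (inj₁ (x<y , y<o))) (inj₂ (inj₂ (z<o , o<y))) = ⊥-elim (<-asym y<o o<y)
cyc-change-base (inj₂ (inj₂ (y<o , o<x))) (inj₁ (o<y , y<z))        = ⊥-elim (<-asym y<o o<y)
cyc-change-base (inj₂ (inj₂ (y<o , o<x))) (inj₂ (inj₁ (y<z , z<o))) = inj₂ (inj₁ (y<z , <-trans z<o o<x))
cyc-change-base (inj₂ (inj₂ (y<o , o<x))) (inj₂ (inj₂ (z<o , o<y))) = ⊥-elim (<-asym y<o o<y)

cyc⇒≢ : ∀ {a b c} → Cycℕ a b c → a ≢ b
cyc⇒≢ (inj₁ (a<b , _))        = <⇒≢ a<b
cyc⇒≢ (inj₂ (inj₁ (b<c , c<a))) = >⇒≢ (<-trans b<c c<a)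
cyc⇒≢ (inj₂ (inj₂ (_ , a<b))) = <⇒≢ a<b

-- Embeddings from sequences that go once around the circle.

module _ (f : ℕ → ℕ) {M : ℕ}
         (steps : ∀ j → 2 + j < M → Cycℕ (f 0) (f (1 + j)) (f (2 + j))) where

  cyc-chain : ∀ a b → suc a < b → b < M → Cycℕ (f 0) (f (suc a)) (f b)
  cyc-chain a (suc b) 1+a<1+b 1+b<M with m<1+n⇒m<n∨m≡n 1+a<1+b
  ... | inj₂ refl = steps a 1+b<M
  cyc-chain a (suc (suc b)) _ 2+b<M | inj₁ 1+a<1+b =
    cyc-trans (cyc-chain a (suc b) 1+a<1+b (<-trans ≤-refl 2+b<M)) (steps b 2+b<M)

  -- Only consecutive values, seen from `f 0`, are compared in `steps`. Transitivity extends this to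
  -- all pairs, and a change of base then removes `f 0` from the triple.
  cyc-increasing : ∀ a b c → a < b → b < c → c < M → Cycℕ (f a) (f b) (f c)
  cyc-increasing zero    (suc b) c a<b b<c c<M = cyc-chain b c b<c c<M
  cyc-increasing (suc a) (suc b) c a<b b<c c<M =
    cyc-change-base (cyc-chain a (suc b) a<b (<-trans b<c c<M)) (cyc-chain b c b<c c<M)

  cyc-distinct : 2 < M → ∀ a b → a < b → b < M → f a ≢ f b
  -- Distinctness is read off a cyclic triple, so the pair `f 0`, `f 1` needs the third value `f 2`.
  cyc-distinct 2<M zero    (suc zero)    a<b b<M = cyc⇒≢ (steps 0 2<M)
  cyc-distinct 2<M zero    (suc (suc b)) a<b b<M =
    cyc⇒≢ (cyc-rotate (cyc-rotate (steps b b<M))) ∘ sym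
  cyc-distinct 2<M (suc a) b a<b b<M = cyc⇒≢ (cyc-rotate (cyc-chain a b a<b b<M))

  module _ {n : ℕ} (f<n : ∀ j → f j < n) where

    place : Fin M → Fin n
    place a = fromℕ< (f<n (toℕ a))

    toℕ-place : ∀ a → toℕ (place a) ≡ f (toℕ a)
    toℕ-place a = toℕ-fromℕ< (f<n (toℕ a))

    place-cyc : CycPreserving place
    place-cyc a b c abc rewrite toℕ-place a | toℕ-place b | toℕ-place c with abc
    ... | inj₁ (a<b , b<c)        = cyc-increasing _ _ _ a<b b<c (toℕ<n c)
    ... | inj₂ (inj₁ (b<c , c<a)) = cyc-rotate (cyc-rotate (cyc-increasing _ _ _ b<c c<a (toℕ<n a)))
    ... | inj₂ (inj₂ (c<a , a<b)) = cyc-rotate (cyc-increasing _ _ _ c<a a<b (toℕ<n b))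

    place-injective : 2 < M → Injective _≡_ _≡_ place
    place-injective 2<M {a} {b} eq with <-cmp (toℕ a) (toℕ b)
      | trans (sym (toℕ-place a)) (trans (cong toℕ eq) (toℕ-place b))
    ... | tri< a<b _ _ | fa≡fb = ⊥-elim (cyc-distinct 2<M _ _ a<b (toℕ<n b) fa≡fb)
    ... | tri≈ _ a≡b _ | _     = toℕ-injective a≡b
    ... | tri> _ _ b<a | fa≡fb = ⊥-elim (cyc-distinct 2<M _ _ b<a (toℕ<n a) (sym fa≡fb))

-- Concatenated sequences and embeddings of X_k.

splice : ℕ → (ℕ → ℕ) → (ℕ → ℕ) → ℕ → ℕ
splice zero    u t j       = t j
splice (suc l) u t zero    = u 0
splice (suc l) u t (suc j) = splice l (u ∘ suc) t j

splice-< : ∀ l u t j → j < l → splice l u t j ≡ u j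
splice-< (suc l) u t zero    _         = refl
splice-< (suc l) u t (suc j) (s≤s j<l) = splice-< l (u ∘ suc) t j j<l

splice-+ : ∀ l u t j → splice l u t (l + j) ≡ t j
splice-+ zero    u t j = refl
splice-+ (suc l) u t j = splice-+ l (u ∘ suc) t j

splice-all : ∀ (P : ℕ → Set) l u t → (∀ j → j < l → P (u j)) → (∀ j → P (t j)) →
  ∀ j → P (splice l u t j)
splice-all P zero    u t pu pt j       = pt j
splice-all P (suc l) u t pu pt zero    = pu 0 (s≤s z≤n)
splice-all P (suc l) u t pu pt (suc j) = splice-all P l (u ∘ suc) t (λ i → pu (suc i) ∘ s≤s) pt j

-- The first piece has `suc l` terms, so its last one is `u l` and the junction is the step from
-- `u l` to `t 0`.
splice-steps : ∀ (Q : ℕ → ℕ → Set) l r u t → (∀ j → j < l → Q (u j) (u (suc j))) → Q (u l) (t 0) →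
  (∀ j → j < r → Q (t j) (t (suc j))) →
  ∀ j → j < suc l + r → Q (splice (suc l) u t j) (splice (suc l) u t (suc j))
splice-steps Q zero    r u t qu qut qt zero    _         = qut
splice-steps Q zero    r u t qu qut qt (suc j) (s≤s j<r) = qt j j<r
splice-steps Q (suc l) r u t qu qut qt zero    _         = qu 0 (s≤s z≤n)
splice-steps Q (suc l) r u t qu qut qt (suc j) (s≤s lt)  =
  splice-steps Q l r (u ∘ suc) t (λ i → qu (suc i) ∘ s≤s) qut qt j lt

-- A copy of X_k with 2k = 2 + w, the vertices 2,…,2k of which are the consecutive
-- numbers β,…,β + w; in the order of X_k the vertices are α, β,…,β + w, γ, δ, ε, ζ.
record Copy (w : ℕ) (Q : ℕ → ℕ → Set) : Set where
  field
    α β γ δ ε ζ : ℕ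
    αε   : Q α ε
    βζ   : Q β ζ
    γδ   : Q γ δ
    path : ∀ j → j < w → Q (β + j) (β + suc j)
    path-cyc : ∀ j → j < w → Cycℕ α (β + j) (β + suc j)
    βγ-cyc : Cycℕ α (β + w) γ
    γδ-cyc : Cycℕ α γ δ
    δε-cyc : Cycℕ α δ ε
    εζ-cyc : Cycℕ α ε ζ

module _ {k w n : ℕ} (2k≡2+w : 2 * k ≡ 2 + w) {Q : ℕ → ℕ → Set} {R : Fin n → Fin n → Set}
         (Q-sym : ∀ {x y} → Q x y → Q y x) (Q-bounded : ∀ {x y} → Q x y → x < n)
         (Q⇒R : ∀ i j → Q (toℕ i) (toℕ j) → R i j) where

  copy⇒contains : Copy w Q → Contains (X k) R
  copy⇒contains copy =
    place f steps f<n , place-injective f steps f<n 2<M , place-cyc f steps f<n ,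
    λ a b e → Q⇒R _ _
      (subst₂ Q (sym (toℕ-place f steps f<n a)) (sym (toℕ-place f steps f<n b)) (X-edge a b e))
    where
    open Copy copy

    tail : ℕ → ℕ
    tail 0 = γ
    tail 1 = δ
    tail 2 = ε
    -- Repeating `ζ` beyond the last vertex keeps `f j < n` true for every `j`, as `place` demands.
    tail _ = ζ

    g f : ℕ → ℕ
    g = splice (suc w) (β +_) tail
    f zero    = α
    f (suc j) = g j

    -- One position for `α` and `suc w` for the path make `2 + w = 2 * k`, so the tail starts at
    -- position `2 * k`.
    f-end : ∀ j → f (2 * k + j) ≡ tail j
    f-end j = trans (cong (λ l → f (l + j)) 2k≡2+w) (splice-+ (suc w) (β +_) tail j)

    2<M : 2 < 2 * k + 4
    2<M = ≤-trans (m≤m+n 3 1) (m≤n+m 4 (2 * k))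

    tail-steps : ∀ j → j < 3 → Cycℕ α (tail j) (tail (suc j))
    tail-steps 0 _ = γδ-cyc
    tail-steps 1 _ = δε-cyc
    tail-steps 2 _ = εζ-cyc
    tail-steps (suc (suc (suc j))) (s≤s (s≤s (s≤s ())))

    steps : ∀ j → 2 + j < 2 * k + 4 → Cycℕ (f 0) (f (1 + j)) (f (2 + j))
    steps j lt =
      splice-steps (Cycℕ α) w 3 (β +_) tail path-cyc βγ-cyc tail-steps j
        (subst (j <_) (+-suc w 3) (s≤s⁻¹ (s≤s⁻¹ (subst (λ l → 2 + j < l + 4) 2k≡2+w lt))))

    β+j<n : ∀ j → j < suc w → β + j < n
    β+j<n zero    _         = subst (_< n) (sym (+-identityʳ β)) (Q-bounded βζ)
    β+j<n (suc j) (s≤s j<w) = Q-bounded (Q-sym (path j j<w))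

    f<n : ∀ j → f j < n
    f<n zero    = Q-bounded αε
    f<n (suc j) = splice-all (_< n) (suc w) (β +_) tail β+j<n tail<n j
      where
      tail<n : ∀ j → tail j < n
      tail<n 0 = Q-bounded γδ
      tail<n 1 = Q-bounded (Q-sym γδ)
      tail<n 2 = Q-bounded (Q-sym αε)
      tail<n (suc (suc (suc _))) = Q-bounded (Q-sym βζ)

    short : ∀ i → 1 ≤ i → i ≤ k → Q (f (2 * i)) (f (2 * i + 1))
    -- The last short edge is `γδ`; all earlier ones are steps of the path.
    short (suc i) _ 1+i≤k with m≤n⇒m<n∨m≡n 1+i≤k
    ... | inj₂ refl =
      subst₂ Q (sym (trans (cong f (sym (+-identityʳ (2 * k)))) (f-end 0))) (sym (f-end 1)) γδ
    ... | inj₁ 2+i≤k = subst₂ Q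
        (sym (splice-< (suc w) (β +_) tail _ (<-trans ≤-refl j+1<1+w)))
        (sym (trans (cong f (+-comm (2 * suc i) 1)) (splice-< (suc w) (β +_) tail _ j+1<1+w)))
        (path _ (s≤s⁻¹ j+1<1+w))
      where
      j+1<1+w : 2 * suc i < suc w
      j+1<1+w = s≤s⁻¹ (subst₂ _≤_ (*-suc 2 (suc i)) 2k≡2+w (*-monoʳ-≤ 2 2+i≤k))

    XE'-edge : ∀ a b → XE' k a b → Q (f (toℕ a)) (f (toℕ b))
    XE'-edge a b (inj₁ (p , q)) rewrite p | q = subst (Q α) (sym (f-end 2)) αε
    XE'-edge a b (inj₂ (inj₁ (p , q))) rewrite p | q =
      subst₂ Q (sym (+-identityʳ β)) (sym (f-end 3)) βζ
    XE'-edge a b (inj₂ (inj₂ (i , 1≤i , i≤k , p , q))) rewrite p | q = short i 1≤i i≤k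

    X-edge : ∀ a b → X k a b → Q (f (toℕ a)) (f (toℕ b))
    X-edge a b (inj₁ e) = XE'-edge a b e
    X-edge a b (inj₂ e) = Q-sym (XE'-edge b a e)

-- The Möbius ladder and its avoidance of X_k.

module Ladder (h m : ℕ) where

  Link : ℕ → ℕ → Set
  Link x y = suc x ≡ y ⊎ h + x ≡ y ⊎ (x ≡ 0 × suc y ≡ m)

  Edge : ℕ → ℕ → Set
  Edge x y = (x < m × y < m) × (Link x y ⊎ Link y x)

  edge? : ∀ x y → Dec (Edge x y)
  edge? x y = ((x <? m) ×-dec (y <? m)) ×-dec (link? x y ⊎-dec link? y x)
    where
    link? : ∀ x y → Dec (Link x y)
    link? x y = (suc x ℕ.≟ y) ⊎-dec (h + x ℕ.≟ y) ⊎-dec ((x ℕ.≟ 0) ×-dec (suc y ℕ.≟ m))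

  edge-sym : ∀ {x y} → Edge x y → Edge y x
  edge-sym ((x<m , y<m) , l) = (y<m , x<m) , swap l

  link⇒edge : ∀ {x y} → Link x y → x < m → y < m → Edge x y
  link⇒edge l x<m y<m = (x<m , y<m) , inj₁ l

  edge-irrefl : 0 < h → 1 < m → ∀ x → ¬ Edge x x
  edge-irrefl 0<h 1<m x (_ , l) = [ link-irrefl , link-irrefl ]′ l
    where
    link-irrefl : ¬ Link x x
    link-irrefl (inj₁ ())
    link-irrefl (inj₂ (inj₁ h+x≡x)) = <⇒≢ (+-monoˡ-≤ x 0<h) (sym h+x≡x)
    link-irrefl (inj₂ (inj₂ (refl , 1≡m))) = <⇒≢ 1<m 1≡m

-- Ahead d m x j: going cyclically around 0,…,m−1 from d, the vertex x comes at least j steps later.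
Ahead : ℕ → ℕ → ℕ → ℕ → Set
Ahead d m x j = d + j ≤ x ⊎ (x < d × d + j ≤ x + m)

ahead-one : ∀ {d m x} → d < m → d ≢ x → Ahead d m x 1
ahead-one {d} {m} {x} d<m d≢x with <-cmp d x
... | tri< d<x _ _ = inj₁ (subst (_≤ x) (+-comm 1 d) d<x)
... | tri≈ _ d≡x _ = ⊥-elim (d≢x d≡x)
... | tri> _ _ x<d = inj₂ (x<d , subst (_≤ x + m) (+-comm 1 d) (≤-trans d<m (m≤n+m m x)))

-- Seen from `d`, the vertex `y` comes strictly after `x`, which costs at least one more step.
ahead-suc : ∀ {d m x y j} → x < m → Cycℕ d x y → Ahead d m x j → Ahead d m y (suc j)
ahead-suc {d} {m} {x} {y} {j} x<m cyc ahead rewrite +-suc d j with cyc | ahead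
... | inj₁ (d<x , x<y)        | inj₁ le         = inj₁ (≤-<-trans le x<y)
... | inj₁ (d<x , x<y)        | inj₂ (x<d , le) = ⊥-elim (<-asym d<x x<d)
... | inj₂ (inj₁ (x<y , y<d)) | inj₁ le         =
  ⊥-elim (<-irrefl refl (<-≤-trans (<-trans x<y y<d) (≤-trans (m≤m+n d j) le)))
... | inj₂ (inj₁ (x<y , y<d)) | inj₂ (x<d , le) = inj₂ (y<d , ≤-<-trans le (+-monoˡ-< m x<y))
-- The move from `x` to `y` wraps around past `m - 1`, and `x < m` accounts for the extra step.
... | inj₂ (inj₂ (y<d , d<x)) | inj₁ le         =
  inj₂ (y<d , ≤-trans (≤-<-trans le x<m) (m≤n+m m y))
... | inj₂ (inj₂ (y<d , d<x)) | inj₂ (x<d , le) = ⊥-elim (<-asym d<x x<d)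

cyc-≤ : ∀ {a b c} → a ≤ c → Cycℕ a b c → a < b × b < c
cyc-≤ a≤c (inj₁ p)                = p
cyc-≤ a≤c (inj₂ (inj₁ (_ , c<a))) = ⊥-elim (<⇒≱ c<a a≤c)
cyc-≤ a≤c (inj₂ (inj₂ (c<a , _))) = ⊥-elim (<⇒≱ c<a a≤c)

descending-not-cyc : ∀ {a b c} → a ≤ b → b ≤ c → ¬ Cycℕ c b a
descending-not-cyc a≤b b≤c (inj₁ (c<b , _))        = <⇒≱ c<b b≤c
descending-not-cyc a≤b b≤c (inj₂ (inj₁ (b<a , _))) = <⇒≱ b<a a≤b
descending-not-cyc a≤b b≤c (inj₂ (inj₂ (_ , c<b))) = <⇒≱ c<b b≤c

module _ {h m : ℕ} (m≤h+h : m ≤ h + h) where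
  open Ladder h m

  -- The vertices `d` and `b` lie on different sides of the edge `ca`; beside a rim edge one side is
  -- empty. For a diagonal, `m ≤ h + h` bounds the arc from `c` to `a` by `h` steps, so from `d`,
  -- strictly inside it, fewer than `h` steps lead to `a`.
  no-crossing : ∀ {a b c d} → Edge c a → b < m → d < m →
    Cycℕ c d a → Cycℕ c a b → ¬ Ahead d m a h
  no-crossing (_ , inj₁ (inj₁ refl)) b<m d<m cda cab ahead
    with c<d , d<a ← cyc-≤ (n≤1+n _) cda = <⇒≱ d<a c<d
  no-crossing (_ , inj₁ (inj₂ (inj₂ (refl , refl)))) b<m d<m cda cab ahead =
    descending-not-cyc z≤n (s≤s⁻¹ b<m) (cyc-rotate cab)
  no-crossing {c = c} {d} (_ , inj₁ (inj₂ (inj₁ refl))) b<m d<m cda cab ahead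
    with ahead | cyc-≤ (m≤n+m c h) cda
  ... | inj₁ d+h≤a     | c<d , d<a =
    <⇒≱ c<d (+-cancelˡ-≤ h d c (subst (_≤ h + c) (+-comm d h) d+h≤a))
  ... | inj₂ (a<d , _) | c<d , d<a = <-asym d<a a<d
  no-crossing (_ , inj₂ (inj₁ refl)) b<m d<m cda cab ahead
    with a<b , b<c ← cyc-≤ (n≤1+n _) (cyc-rotate cab) = <⇒≱ b<c a<b
  no-crossing {d = d} ((c<m , _) , inj₂ (inj₂ (inj₁ refl))) b<m d<m cda cab (inj₁ d+h≤a) =
    <⇒≱ c<m (≤-trans m≤h+h (+-monoʳ-≤ h (≤-trans (m≤n+m h d) d+h≤a)))
  no-crossing {a} {d = d} (_ , inj₂ (inj₂ (inj₁ refl))) b<m d<m cda cab (inj₂ (a<d , d+h≤a+m)) =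
    descending-not-cyc (<⇒≤ a<d) d≤c cda
    where
    open ≤-Reasoning
    d≤c : d ≤ h + a
    d≤c = +-cancelʳ-≤ h d (h + a) (begin
      d + h        ≤⟨ d+h≤a+m ⟩
      a + m        ≤⟨ +-monoʳ-≤ a m≤h+h ⟩
      a + (h + h)  ≡⟨ +-assoc a h h ⟨
      a + h + h    ≡⟨ cong (_+ h) (+-comm a h) ⟩
      h + a + h    ∎)
  no-crossing (_ , inj₂ (inj₂ (inj₂ (refl , refl)))) b<m d<m cda cab ahead =
    descending-not-cyc z≤n (s≤s⁻¹ d<m) cda

  module _ {k n : ℕ} (h≡ : h ≡ suc (2 * k)) {R : Fin n → Fin n → Set}
           (R⇒Edge : ∀ i j → R i j → Edge (toℕ i) (toℕ j)) where

    ladder-avoids-X : Avoids (X k) R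
    ladder-avoids-X (φ , _ , φ-cyc , φ-edge) =
      -- `p 1` and `p (2 * k + 3)` lie on the two sides of the edge from `p 0` to `p (2 * k + 2)`.
      -- Taking `i = k` in `p-ahead` puts `p (2 * k + 2)` at least `2 * k + 1 = h` steps after
      -- `p 1`.
      no-crossing crossing (proj₂ (proj₁ crossed)) p1<m
        (p-cyc 0 1 (2 * k + 2) ≤-refl (m≤n+m 2 (2 * k)) 2k+2<M)
        (p-cyc 0 (2 * k + 2) (2 * k + 3) (≤-trans (s≤s z≤n) (m≤n+m 2 (2 * k)))
          (≤-reflexive (sym (+-suc (2 * k) 2))) 2k+3<M)
        (subst₂ (Ahead (p 1) m) (cong p (trans (*-suc 2 k) (+-comm 2 (2 * k)))) (sym h≡) (p-ahead k ≤-refl))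
      where
      instance
        nonZero : NonZero (2 * k + 4)
        nonZero = >-nonZero (≤-trans (s≤s z≤n) (m≤n+m 4 (2 * k)))

      2k+3<M : 2 * k + 3 < 2 * k + 4
      2k+3<M = ≤-reflexive (sym (+-suc (2 * k) 3))

      2k+2<M : 2 * k + 2 < 2 * k + 4
      2k+2<M = +-monoʳ-< (2 * k) (n≤1+n 3)

      1<M : 1 < 2 * k + 4
      1<M = ≤-trans (s≤s (s≤s z≤n)) (m≤n+m 4 (2 * k))

      -- Reduction `mod` makes positions total on numbers, so `p` is a plain sequence; in the range
      -- that matters it is the identity.
      vertex : ℕ → Fin (2 * k + 4)
      vertex j = j mod (2 * k + 4)

      toℕ-vertex : ∀ {j} → j < 2 * k + 4 → toℕ (vertex j) ≡ j
      toℕ-vertex j<M = trans (toℕ-fromℕ< _) (m<n⇒m%n≡m j<M)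

      p : ℕ → ℕ
      p = toℕ ∘ φ ∘ vertex

      p-cyc : ∀ a b c → a < b → b < c → c < 2 * k + 4 → Cycℕ (p a) (p b) (p c)
      p-cyc a b c a<b b<c c<M = φ-cyc _ _ _ (inj₁ (lemma a b c a<b b<c c<M))
        where
        lemma : ∀ a b c → a < b → b < c → c < 2 * k + 4 →
          toℕ (vertex a) < toℕ (vertex b) × toℕ (vertex b) < toℕ (vertex c)
        lemma a b c a<b b<c c<M
          rewrite toℕ-vertex c<M | toℕ-vertex (<-trans b<c c<M)
                | toℕ-vertex (<-trans a<b (<-trans b<c c<M)) =
          a<b , b<c

      p-edge : ∀ a b → X k (vertex a) (vertex b) → Edge (p a) (p b)
      p-edge a b = R⇒Edge _ _ ∘ φ-edge _ _

      crossing : Edge (p 0) (p (2 * k + 2))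
      crossing = p-edge 0 _ (inj₁ (inj₁ (toℕ-vertex (<-trans (s≤s z≤n) 1<M) , toℕ-vertex 2k+2<M)))

      crossed : Edge (p 1) (p (2 * k + 3))
      crossed = p-edge 1 _ (inj₁ (inj₂ (inj₁ (toℕ-vertex 1<M , toℕ-vertex 2k+3<M))))

      p1<m : p 1 < m
      p1<m = proj₁ (proj₁ crossed)

      -- Every position costs one step. The short edges enter through their ends, which have to be
      -- among the first `m` vertices, as `ahead-suc` requires.
      p-ahead : ∀ i → i ≤ k → Ahead (p 1) m (p (2 * suc i)) (suc (2 * i))
      p-ahead zero    _     = ahead-one p1<m (cyc⇒≢ (p-cyc 1 2 3 ≤-refl ≤-refl (m≤n+m 4 (2 * k))))
      p-ahead (suc i) 1+i≤k =
        subst₂ (λ x j → Ahead (p 1) m (p x) (suc j)) (sym (*-suc 2 (suc i))) (sym (*-suc 2 i))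
          (ahead-suc (proj₂ (proj₁ edge)) (p-cyc 1 (suc j) (2 + j) (s≤s (s≤s z≤n)) ≤-refl 2+j<M)
            (ahead-suc (proj₁ (proj₁ edge))
              (p-cyc 1 j (suc j) (*-monoʳ-≤ 2 (s≤s (z≤n {i}))) ≤-refl (<-trans ≤-refl 2+j<M))
              (p-ahead i (<⇒≤ 1+i≤k))))
        where
        j : ℕ
        j = 2 * suc i

        2+j<M : 2 + j < 2 * k + 4
        2+j<M = ≤-<-trans (≤-reflexive (+-comm 2 j))
          (+-mono-≤-< (*-monoʳ-≤ 2 1+i≤k) (s≤s (s≤s (s≤s z≤n))))

        edge : Edge (p j) (p (suc j))
        edge = p-edge j (suc j) (inj₁ (inj₂ (inj₂ (suc i , s≤s z≤n , 1+i≤k ,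
          toℕ-vertex (<-trans ≤-refl (<-trans ≤-refl 2+j<M)) ,
          trans (toℕ-vertex (<-trans ≤-refl 2+j<M)) (+-comm 1 j)))))

-- Copies of X_k created by an edge leaving the ladder.

module _ (w : ℕ) where

  -- Twice `h = 3 + w`. With `2 * k = 2 + w` this `h` is `2 * k + 1`; the parameter `w` avoids
  -- subtraction.
  m : ℕ
  m = 6 + (w + w)

  open Ladder (3 + w) m

  With : ℕ → ℕ → ℕ → ℕ → Set
  With u v x y = Edge x y ⊎ (x ≡ u × y ≡ v) ⊎ (x ≡ v × y ≡ u)

  module _ {u v : ℕ} where

    with-sym : ∀ {x y} → With u v x y → With u v y x
    with-sym (inj₁ e)               = inj₁ (edge-sym e)
    with-sym (inj₂ (inj₁ (p , q))) = inj₂ (inj₂ (q , p))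
    with-sym (inj₂ (inj₂ (p , q))) = inj₂ (inj₁ (q , p))

    rim : ∀ {x y} → suc x ≡ y → y < m → With u v x y
    rim refl y<m = inj₁ (link⇒edge (inj₁ refl) (<-trans ≤-refl y<m) y<m)

    diagonal : ∀ {x y} → x + (3 + w) ≡ y → y < m → With u v y x
    diagonal {x} refl y<m =
      inj₁ (edge-sym (link⇒edge (inj₂ (inj₁ (+-comm (3 + w) x))) (≤-<-trans (m≤m+n x (3 + w)) y<m) y<m))

    closing : With u v 0 (5 + (w + w))
    closing = inj₁ (link⇒edge (inj₂ (inj₂ (refl , refl))) (s≤s z≤n) ≤-refl)

    new : With u v u v
    new = inj₂ (inj₁ (refl , refl))

  private
    w≤w+w : w ≤ w + w
    w≤w+w = m≤m+n w w

    w+1+j≤w+w : ∀ {j} → j < w → w + suc j ≤ w + w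
    w+1+j≤w+w = +-monoʳ-≤ w

    ≤⇒<3+ : ∀ {x y} → x ≤ y → x < 3 + y
    ≤⇒<3+ x≤y = s≤s (≤-trans x≤y (m≤n+m _ 2))

  -- The diagonals from `3 + w` to 0 and from `4 + w` to 1 cross. The path ends at `m - 2`, so the
  -- new edge fits behind it as the last short edge.
  copy-right : ∀ {u v} → 5 + (w + w) ≤ u → u < v → Copy w (With u v)
  copy-right {u} {v} m≤1+u u<v = record
    { α = 3 + w ; β = 4 + w ; γ = u ; δ = v ; ε = 0 ; ζ = 1
    ; αε = diagonal refl (s≤s (s≤s (s≤s (≤⇒<3+ w≤w+w))))
    ; βζ = diagonal refl (s≤s (s≤s (s≤s (s≤s (s≤s (≤-trans w≤w+w (n≤1+n _)))))))
    ; γδ = new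
    ; path = λ j j<w → rim (sym (+-suc (4 + w) j))
        (s≤s (s≤s (s≤s (s≤s (s≤s (≤-trans (w+1+j≤w+w j<w) (n≤1+n _)))))))
    ; path-cyc = λ j j<w → inj₁ (s≤s (m≤m+n (3 + w) j) , +-monoʳ-< (4 + w) ≤-refl)
    ; βγ-cyc = inj₁ (s≤s (m≤m+n (3 + w) w) , m≤1+u)
    ; γδ-cyc = inj₁ (h<u , u<v)
    ; δε-cyc = inj₂ (inj₂ (s≤s z≤n , <-trans h<u u<v))
    ; εζ-cyc = inj₂ (inj₁ (≤-refl , s≤s (s≤s z≤n)))
    }
    where
    h<u : 3 + w < u
    h<u = ≤-trans (s≤s (s≤s (s≤s (s≤s (≤-trans w≤w+w (n≤1+n _)))))) m≤1+u

  -- This is `copy-right` turned by one step: the path ends at `m - 1`, and the new edge, read from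
  -- `v` to 0, is the last short edge.
  copy-zero : ∀ {v} → m ≤ v → Copy w (With 0 v)
  copy-zero {v} m≤v = record
    { α = 4 + w ; β = 5 + w ; γ = v ; δ = 0 ; ε = 1 ; ζ = 2
    ; αε = diagonal refl (s≤s (s≤s (s≤s (s≤s (s≤s (≤-trans w≤w+w (n≤1+n _)))))))
    ; βζ = diagonal refl (s≤s (s≤s (s≤s (s≤s (s≤s (s≤s w≤w+w))))))
    ; γδ = with-sym new
    ; path = λ j j<w → rim (sym (+-suc (5 + w) j))
        (s≤s (s≤s (s≤s (s≤s (s≤s (s≤s (w+1+j≤w+w j<w)))))))
    ; path-cyc = λ j j<w → inj₁ (s≤s (m≤m+n (4 + w) j) , +-monoʳ-< (5 + w) ≤-refl)
    ; βγ-cyc = inj₁ (s≤s (m≤m+n (4 + w) w) , m≤v)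
    ; γδ-cyc = inj₂ (inj₂ (s≤s z≤n ,
        ≤-trans (s≤s (s≤s (s≤s (s≤s (s≤s (≤-trans w≤w+w (n≤1+n _))))))) m≤v))
    ; δε-cyc = inj₂ (inj₁ (≤-refl , s≤s (s≤s z≤n)))
    ; εζ-cyc = inj₂ (inj₁ (≤-refl , s≤s (s≤s (s≤s z≤n))))
    }

  -- The new edge crosses the rim edge between 0 and `m - 1`. As `u ≤ 2 + w`, the `2 + w` vertices
  -- following `u` stay below `m - 1` and carry the short edges.
  copy-before : ∀ {u v} → 1 ≤ u → u ≤ 2 + w → m ≤ v → Copy w (With u v)
  copy-before {u} {v} 1≤u u≤2+w m≤v = record
    { α = 0 ; β = u ; γ = u + (1 + w) ; δ = u + (2 + w) ; ε = 5 + (w + w) ; ζ = v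
    ; αε = closing
    ; βζ = new
    ; γδ = rim (sym (+-suc u (1 + w))) (<-trans δ<ε ≤-refl)
    ; path = λ j j<w → rim (sym (+-suc u j))
        (≤-<-trans (+-monoʳ-≤ u (≤-trans j<w (m≤n+m w 2))) (<-trans δ<ε ≤-refl))
    ; path-cyc = λ j j<w → inj₁ (≤-trans 1≤u (m≤m+n u j) , +-monoʳ-< u ≤-refl)
    ; βγ-cyc = inj₁ (≤-trans 1≤u (m≤m+n u w) , +-monoʳ-< u ≤-refl)
    ; γδ-cyc = inj₁ (≤-trans 1≤u (m≤m+n u (1 + w)) , +-monoʳ-< u ≤-refl)
    ; δε-cyc = inj₁ (≤-trans 1≤u (m≤m+n u (2 + w)) , δ<ε)
    ; εζ-cyc = inj₁ (s≤s z≤n , m≤v)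
    }
    where
    open ≤-Reasoning
    δ<ε : u + (2 + w) < 5 + (w + w)
    δ<ε = s≤s (begin
      u + (2 + w)        ≤⟨ +-monoˡ-≤ (2 + w) u≤2+w ⟩
      2 + (w + (2 + w))  ≡⟨ cong (2 +_) (trans (+-suc w (1 + w)) (cong suc (+-suc w w))) ⟩
      4 + (w + w)        ∎)

  -- The same crossing with the roles exchanged: now the short edges lie on `1, …, 2 + w`, between 0
  -- and `u`.
  copy-after : ∀ {u v} → 3 + w ≤ u → u < 5 + (w + w) → m ≤ v → Copy w (With u v)
  copy-after {u} {v} 3+w≤u u<m-1 m≤v = record
    { α = v ; β = 0 ; γ = 1 + w ; δ = 2 + w ; ε = u ; ζ = 5 + (w + w)
    ; αε = with-sym new
    ; βζ = closing
    ; γδ = rim refl (<-trans 2+w<u (<-trans u<m-1 ≤-refl))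
    ; path = λ j j<w → rim refl (≤-<-trans j<w (≤-trans w<u (<⇒≤ (<-trans u<m-1 ≤-refl))))
    ; path-cyc = λ j j<w → inj₂ (inj₁ (≤-refl , ≤-<-trans j<w (<-trans w<u u<v)))
    ; βγ-cyc = inj₂ (inj₁ (≤-refl , <-trans 1+w<u u<v))
    ; γδ-cyc = inj₂ (inj₁ (≤-refl , <-trans 2+w<u u<v))
    ; δε-cyc = inj₂ (inj₁ (2+w<u , u<v))
    ; εζ-cyc = inj₂ (inj₁ (u<m-1 , m≤v))
    }
    where
    2+w<u : 2 + w < u
    2+w<u = 3+w≤u
    1+w<u : 1 + w < u
    1+w<u = <-trans ≤-refl 2+w<u
    w<u : w < u
    w<u = <-trans ≤-refl 1+w<u
    u<v : u < v
    u<v = <-trans u<m-1 m≤v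

  copy : ∀ u v → u < v → m ≤ v → Copy w (With u v)
  copy zero v u<v m≤v = copy-zero m≤v
  copy u@(suc _) v u<v m≤v with u ≤? 2 + w | 5 + (w + w) ≤? u
  ... | yes u≤2+w | _          = copy-before (s≤s z≤n) u≤2+w m≤v
  ... | no _      | yes m-1≤u  = copy-right m-1≤u u<v
  ... | no u≰2+w  | no m-1≰u   = copy-after (≰⇒> u≰2+w) (≰⇒> m-1≰u) m≤v

  -- Saturated graphs containing the ladder.

  module _ (n : ℕ) where

    private
      loopless : ∀ (i : Fin n) → ¬ Edge (toℕ i) (toℕ i)
      loopless i = edge-irrefl (s≤s z≤n) (s≤s (s≤s z≤n)) (toℕ i)

    -- For `n < m` this is the part of the Möbius ladder on the available vertices, so small `n`
    -- need no separate treatment.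
    ladder : Graph n
    ladder = fromRel (λ i j → edge? (toℕ i) (toℕ j)) edge-sym loopless

    E⇒Edge : ∀ i j → E ladder i j → Edge (toℕ i) (toℕ j)
    E⇒Edge = E⇒R (λ i j → edge? (toℕ i) (toℕ j)) edge-sym loopless

    Edge⇒E : ∀ i j → Edge (toℕ i) (toℕ j) → E ladder i j
    Edge⇒E = R⇒E (λ i j → edge? (toℕ i) (toℕ j)) edge-sym loopless

    module _ {k : ℕ} (2k≡2+w : 2 * k ≡ 2 + w) where

      ladder-avoids : Avoids (X k) (E ladder)
      ladder-avoids = ladder-avoids-X (≤-reflexive m≡h+h) (cong suc (sym 2k≡2+w)) E⇒Edge
        where
        m≡h+h : m ≡ 3 + w + (3 + w)
        m≡h+h = cong (3 +_) (+-comm (3 + w) w)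

      far-edge-creates-X : ∀ u v → toℕ u < toℕ v → m ≤ toℕ v → Contains (X k) (plusEdge ladder u v)
      far-edge-creates-X u v u<v m≤v =
        copy⇒contains 2k≡2+w with-sym bounded with⇒plusEdge (copy (toℕ u) (toℕ v) u<v m≤v)
        where
        bounded : ∀ {x y} → With (toℕ u) (toℕ v) x y → x < n
        -- A vertex `v` with `m ≤ toℕ v` forces `m < n`, so the whole ladder is present.
        bounded (inj₁ ((x<m , _) , _))     = <-≤-trans x<m (≤-trans m≤v (<⇒≤ (toℕ<n v)))
        bounded (inj₂ (inj₁ (refl , _))) = toℕ<n u
        bounded (inj₂ (inj₂ (refl , _))) = toℕ<n v

        with⇒plusEdge : ∀ i j → With (toℕ u) (toℕ v) (toℕ i) (toℕ j) → plusEdge ladder u v i j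
        with⇒plusEdge i j (inj₁ e) = inj₁ (Edge⇒E i j e)
        with⇒plusEdge i j (inj₂ (inj₁ (p , q))) = inj₂ (inj₁ (toℕ-injective p , toℕ-injective q))
        with⇒plusEdge i j (inj₂ (inj₂ (p , q))) = inj₂ (inj₂ (toℕ-injective p , toℕ-injective q))

      module _ (H : Graph n) (G⊆H : ∀ i j → E ladder i j → E H i j) (avoids : Avoids (X k) (E H)) where

        -- Such an edge of `H` would, together with the ladder inside `H`, complete a copy of X_k.
        no-far-edge : ∀ u v → toℕ u < toℕ v → m ≤ toℕ v → ¬ E H u v
        no-far-edge u v u<v m≤v uv∈H = avoids (Contains-mono within (far-edge-creates-X u v u<v m≤v))
          where
          within : ∀ i j → plusEdge ladder u v i j → E H i j
          within i j (inj₁ e)                     = G⊆H i j e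
          within i j (inj₂ (inj₁ (refl , refl))) = uv∈H
          within i j (inj₂ (inj₂ (refl , refl))) = trans (symm H v u) uv∈H

        avoiding-extension-support : ∀ i j → m ≤ toℕ i ⊎ m ≤ toℕ j → ¬ E H i j
        avoiding-extension-support i j far ij∈H with <-cmp (toℕ i) (toℕ j)
        ... | tri< i<j _ _ =
          no-far-edge i j i<j ([ (λ m≤i → ≤-trans m≤i (<⇒≤ i<j)) , id ]′ far) ij∈H
        ... | tri> _ _ j<i =
          no-far-edge j i j<i ([ id , (λ m≤j → ≤-trans m≤j (<⇒≤ j<i)) ]′ far)
            (trans (symm H j i) ij∈H)
        ... | tri≈ _ i≡j _ with refl ← toℕ-injective i≡j with () ← trans (sym ij∈H) (irr H i)

theorem8 : (k : ℕ) → 1 ≤ k →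
    ∃[ c ] ((n : ℕ) → ∃[ H ] (Saturates {n = n} (X k) H × edgeCount H ≤ c))
-- The bound is the square of the number `m w` of ladder vertices, which is fixed before `n` is
-- chosen.
theorem8 (suc k) _ = m w * (m w * 1) , λ n →
  let H , G⊆H , sat = extend-to-saturated (X? (suc k)) (ladder w n) (ladder-avoids w n 2k≡2+w)
  in H , sat , edgeCount-support (m w) H (avoiding-extension-support w n 2k≡2+w H G⊆H (proj₁ sat))
  where
  w : ℕ
  w = 2 * k
  2k≡2+w : 2 * suc k ≡ 2 + w
  2k≡2+w = *-suc 2 k
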